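{- Let $P=(p_n)$ and $Q=(q_n)$ be basic sequences. Then $\psi_{P,Q}$ is monotone on no intervals (that is, there is no non-degenerate interval in $\mathbb{R}$ on which $\psi_{P,Q}$ is monotone) if and only if $p_n>q_n$ for infinitely many $n$.
   Context: A basic sequence is a sequence of integers $\ge2$. The $P$-Cantor series expansion of $x\in\mathbb{R}$, abbreviated $x=E_0.E_1E_2\cdots$ w.r.t. $P$, is the unique expansion $x=E_0+\sum_{n\ge1}\frac{E_n}{p_1\cdots p_n}$ with $E_0=\lfloor x\rfloor$, $E_n\in\{0,\ldots,p_n-1\}$ for $n\ge 1$, and $E_n\ne p_n-1$ infinitely often. For such $x$, $\psi_{P,Q}(x)=\sum_{n\ge1}\frac{\min(E_n,q_n-1)}{q_1\cdots q_n}$. -}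

module Defs where

open import Axiom.ExcludedMiddle using (ExcludedMiddle)
open import Data.Empty using (⊥-elim)
open import Data.Integer as ℤ using (ℤ; +_; -[1+_])
import Data.Integer.Properties as ℤ
open import Data.Integer.Solver using (module +-*-Solver)
open import Data.Nat as ℕ using (ℕ; zero; suc; s≤s; z≤n)
import Data.Nat.Properties as ℕ
open import Data.Product using (∃-syntax; _×_; _,_; proj₁; proj₂)
open import Data.Rational as ℚ using (ℚ; mkℚ; 0ℚ; 1ℚ; _/_)
import Data.Rational.Properties as ℚ
import Data.Rational.Unnormalised as ℚᵘ
import Data.Rational.Unnormalised.Properties as ℚᵘ
open import Data.Sum using (_⊎_; inj₁; inj₂)
open import Level using (0ℓ)
open import Relation.Binary.PropositionalEquality
  using (_≡_; _≢_; refl; sym; trans; cong; subst; subst₂)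
open import Relation.Nullary using (¬_; yes; no)
open import Relation.Nullary.Decidable using (decidable-stable)
open import Relation.Unary using (Pred; _∈_; _∉_)

-- The real numbers, as lower Dedekind cuts.  In the presence of excluded
-- middle, on which everything about ψ below depends, these are the
-- classical reals.  Two cuts represent the same real when each is ≤ the
-- other.

record ℝ : Set₁ where
  field
    lower     : Pred ℚ 0ℓ
    inhabited : ∃[ q ] q ∈ lower
    proper    : ∃[ q ] q ∉ lower
    down      : ∀ {p q} → p ℚ.< q → q ∈ lower → p ∈ lower
    rounded   : ∀ {p} → p ∈ lower → ∃[ q ] p ℚ.< q × q ∈ lower

open ℝ

infix 4 _≤_ _<_

_≤_ : ℝ → ℝ → Set
x ≤ y = ∀ {q} → q ∈ lower x → q ∈ lower y

_<_ : ℝ → ℝ → Set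
x < y = x ≤ y × ¬ (y ≤ x)

private
  q-1<q : ∀ q → q ℚ.- 1ℚ ℚ.< q
  q-1<q q = subst (q ℚ.- 1ℚ ℚ.<_) (ℚ.+-identityʳ q)
    (ℚ.+-monoʳ-< q (ℚ.negative⁻¹ (ℚ.- 1ℚ)))

infix 9 _⋆

_⋆ : ℚ → ℝ
q ⋆ = record
  { lower     = ℚ._< q
  ; inhabited = q ℚ.- 1ℚ , q-1<q q
  ; proper    = q , ℚ.<-irrefl refl
  ; down      = ℚ.<-trans
  ; rounded   = λ p<q → ℚ.<-dense p<q
  }

-- |sₙ - x| < ε is expressed as sₙ - ε < x < sₙ + ε.

infix 4 _⟶_

_⟶_ : (ℕ → ℚ) → ℝ → Set
s ⟶ x = ∀ ε → 0ℚ ℚ.< ε →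
  ∃[ N ] ∀ n → N ℕ.≤ n → (s n ℚ.- ε) ⋆ < x × x < (s n ℚ.+ ε) ⋆

IsInterval : Pred ℝ 0ℓ → Set₁
IsInterval I = ∀ {x y z} → x ∈ I → z ∈ I → x ≤ y → y ≤ z → y ∈ I

NonDegenerate : Pred ℝ 0ℓ → Set₁
NonDegenerate I = ∃[ x ] ∃[ y ] x ∈ I × y ∈ I × x < y

NonDecreasingOn NonIncreasingOn MonotoneOn : (ℝ → ℝ) → Pred ℝ 0ℓ → Set₁
NonDecreasingOn f I = ∀ {x y} → x ∈ I → y ∈ I → x ≤ y → f x ≤ f y
NonIncreasingOn f I = ∀ {x y} → x ∈ I → y ∈ I → x ≤ y → f y ≤ f x
MonotoneOn f I = NonDecreasingOn f I ⊎ NonIncreasingOn f I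

MonotoneOnNoInterval : (ℝ → ℝ) → Set₁
MonotoneOnNoInterval f =
  ¬ (∃[ I ] IsInterval I × NonDegenerate I × MonotoneOn f I)

InfinitelyOften : Pred ℕ 0ℓ → Set
InfinitelyOften A = ∀ N → ∃[ n ] N ℕ.≤ n × A n

-- Sequences indexed by n ≥ 1 on paper are indexed from 0 here: `at P n` is
-- pₙ₊₁, and likewise for digits.

record BasicSequence : Set where
  field
    at   : ℕ → ℕ
    2≤at : ∀ n → 2 ℕ.≤ at n

open BasicSequence public

-- ∏ P n = p₁ ⋯ pₙ

∏ : BasicSequence → ℕ → ℕ
∏ P zero    = 1
∏ P (suc n) = ∏ P n ℕ.* at P n

at-nonZero : ∀ P n → ℕ.NonZero (at P n)
at-nonZero P n = ℕ.>-nonZero (ℕ.<-trans (s≤s z≤n) (2≤at P n))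

∏-nonZero : ∀ P n → ℕ.NonZero (∏ P n)
∏-nonZero P zero    = _
∏-nonZero P (suc n) = ℕ.m*n≢0 (∏ P n) (at P n) {{∏-nonZero P n}} {{at-nonZero P n}}

-- frac P e n = e / (p₁ ⋯ pₙ)

frac : BasicSequence → ℕ → ℕ → ℚ
frac P e n = (+ e / ∏ P n) {{∏-nonZero P n}}

-- digitSum P e n = e₁/p₁ + e₂/(p₁p₂) + ⋯ + eₙ/(p₁⋯pₙ)

digitSum : BasicSequence → (ℕ → ℕ) → ℕ → ℚ
digitSum P e zero    = 0ℚ
digitSum P e (suc n) = digitSum P e n ℚ.+ frac P (e n) (suc n)

record Expansion (P : BasicSequence) (x : ℝ) : Set where
  field
    E₀           : ℤ
    E₀≤x         : (E₀ / 1) ⋆ ≤ x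
    x<E₀+1       : x < ((E₀ ℤ.+ + 1) / 1) ⋆
    E            : ℕ → ℕ
    E<p          : ∀ n → E n ℕ.< at P n
    E≢p-1        : InfinitelyOften (λ n → E n ≢ at P n ℕ.∸ 1)
    converges    : (λ n → (E₀ / 1) ℚ.+ digitSum P E n) ⟶ x

module Lemmas where

  /-+ : ∀ i j d .{{_ : ℕ.NonZero d}} → (i / d) ℚ.+ (j / d) ≡ (i ℤ.+ j) / d
  /-+ i j (suc d) = ℚ.toℚᵘ-injective (begin
    ℚ.toℚᵘ ((i / suc d) ℚ.+ (j / suc d))
      ≈⟨ ℚ.toℚᵘ-homo-+ (i / suc d) (j / suc d) ⟩
    ℚ.toℚᵘ (i / suc d) ℚᵘ.+ ℚ.toℚᵘ (j / suc d)
      ≈⟨ ℚᵘ.+-cong (ℚ.toℚᵘ-fromℚᵘ (ℚᵘ.mkℚᵘ i d)) (ℚ.toℚᵘ-fromℚᵘ (ℚᵘ.mkℚᵘ j d)) ⟩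
    ℚᵘ.mkℚᵘ i d ℚᵘ.+ ℚᵘ.mkℚᵘ j d
      ≈⟨ ℚᵘ.*≡* (solve 3 (λ i j D → (i :* D :+ j :* D) :* D := (i :+ j) :* (D :* D)) refl i j (+ suc d)) ⟩
    ℚᵘ.mkℚᵘ (i ℤ.+ j) d
      ≈⟨ ℚᵘ.≃-sym (ℚ.toℚᵘ-fromℚᵘ (ℚᵘ.mkℚᵘ (i ℤ.+ j) d)) ⟩
    ℚ.toℚᵘ ((i ℤ.+ j) / suc d) ∎)
    where
    open ℚᵘ.≃-Reasoning
    open +-*-Solver

  /-mono : ∀ {i j} d .{{_ : ℕ.NonZero d}} → i ℤ.≤ j → i / d ℚ.≤ j / d
  /-mono {i} {j} (suc d) i≤j = ℚ.toℚᵘ-cancel-≤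
    (ℚᵘ.≤-respˡ-≃ (ℚᵘ.≃-sym (ℚ.toℚᵘ-fromℚᵘ (ℚᵘ.mkℚᵘ i d)))
    (ℚᵘ.≤-respʳ-≃ (ℚᵘ.≃-sym (ℚ.toℚᵘ-fromℚᵘ (ℚᵘ.mkℚᵘ j d)))
    (ℚᵘ.*≤* (ℤ.*-monoʳ-≤-nonNeg (+ suc d) i≤j))))

  cancel/ : ∀ q p .{{_ : ℕ.NonZero q}} .{{_ : ℕ.NonZero p}} .{{_ : ℕ.NonZero (q ℕ.* p)}} →
            + p / (q ℕ.* p) ≡ + 1 / q
  cancel/ (suc q) (suc p) = ℚ.fromℚᵘ-cong {ℚᵘ.mkℚᵘ (+ suc p) (p ℕ.+ q ℕ.* suc p)} {ℚᵘ.mkℚᵘ (+ 1) q}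
    (ℚᵘ.*≡* (trans (sym (ℤ.pos-* (suc p) (suc q)))
            (trans (cong +_ (trans (ℕ.*-comm (suc p) (suc q)) (sym (ℕ.*-identityˡ _))))
                   (ℤ.pos-* 1 (suc q ℕ.* suc p)))))

  1/small : ∀ ε → 0ℚ ℚ.< ε →
            ∃[ k ] ∀ d .{{_ : ℕ.NonZero d}} → k ℕ.< d → + 1 / d ℚ.< ε
  1/small (mkℚ (+ 0) d _) (ℚ.*<* (ℤ.+<+ ()))
  1/small ε@(mkℚ (+ suc a) d _) _ = suc d , λ where
    (suc e) (s≤s k<e) → ℚ.toℚᵘ-cancel-<
      (ℚᵘ.<-respˡ-≃ (ℚᵘ.≃-sym (ℚ.toℚᵘ-fromℚᵘ (ℚᵘ.mkℚᵘ (+ 1) e)))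
      (ℚᵘ.*<* (subst₂ ℤ._<_ (ℤ.pos-* 1 (suc d)) (ℤ.pos-* (suc a) (suc e))
        (ℤ.+<+ (ℕ.≤-trans (s≤s (subst (ℕ._≤ e) (sym (ℕ.*-identityˡ (suc d))) k<e))
                          (ℕ.m≤n*m (suc e) (suc a)))))))
  1/small (mkℚ -[1+ a ] d _) (ℚ.*<* ())

  n<∏ : ∀ P n → n ℕ.< ∏ P n
  n<∏ P zero    = s≤s z≤n
  n<∏ P (suc n) = begin
    2 ℕ.+ n             ≤⟨ s≤s (n<∏ P n) ⟩
    1 ℕ.+ ∏ P n         ≤⟨ ℕ.+-monoˡ-≤ (∏ P n) (ℕ.>-nonZero⁻¹ (∏ P n) {{∏-nonZero P n}}) ⟩
    ∏ P n ℕ.+ ∏ P n     ≡⟨ cong (∏ P n ℕ.+_) (sym (ℕ.+-identityʳ (∏ P n))) ⟩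
    2 ℕ.* ∏ P n         ≡⟨ ℕ.*-comm 2 (∏ P n) ⟩
    ∏ P n ℕ.* 2         ≤⟨ ℕ.*-monoʳ-≤ (∏ P n) (2≤at P n) ⟩
    ∏ P n ℕ.* at P n    ∎
    where open ℕ.≤-Reasoning

  ≤-bound : ∀ q → q ℚ.≤ + suc ℤ.∣ ℚ.↥ q ∣ / 1
  ≤-bound q@(mkℚ n d _) = ℚ.toℚᵘ-cancel-≤
    (ℚᵘ.≤-respʳ-≃ (ℚᵘ.≃-sym (ℚ.toℚᵘ-fromℚᵘ (ℚᵘ.mkℚᵘ (+ suc ℤ.∣ n ∣) 0)))
    (ℚᵘ.*≤* (begin
      n ℤ.* + 1                 ≡⟨ ℤ.*-identityʳ n ⟩
      n                         ≤⟨ i≤∣i∣ n ⟩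
      + ℤ.∣ n ∣                 ≤⟨ ℤ.+≤+ (ℕ.≤-trans (ℕ.n≤1+n _) (ℕ.m≤m*n (suc ℤ.∣ n ∣) (suc d))) ⟩
      + (suc ℤ.∣ n ∣ ℕ.* suc d) ≡⟨ ℤ.pos-* (suc ℤ.∣ n ∣) (suc d) ⟩
      + suc ℤ.∣ n ∣ ℤ.* + suc d ∎)))
    where
    open ℤ.≤-Reasoning
    i≤∣i∣ : ∀ i → i ℤ.≤ + ℤ.∣ i ∣
    i≤∣i∣ (+ _)     = ℤ.≤-refl
    i≤∣i∣ -[1+ _ ] = ℤ.-≤+

  bound-≤ : ∀ q → -[1+ ℤ.∣ ℚ.↥ (ℚ.- q) ∣ ] / 1 ℚ.≤ q
  bound-≤ q = subst (-[1+ ℤ.∣ ℚ.↥ (ℚ.- q) ∣ ] / 1 ℚ.≤_) (neg-neg q)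
    (ℚ.neg-antimono-≤ (≤-bound (ℚ.- q)))
    where
    neg-neg : ∀ q → ℚ.- (ℚ.- q) ≡ q
    neg-neg (mkℚ (+ 0) _ _)     = refl
    neg-neg (mkℚ (+ suc _) _ _) = refl
    neg-neg (mkℚ -[1+ _ ] _ _)  = refl

  ⋆-mono : ∀ {p q} → p ℚ.≤ q → p ⋆ ≤ q ⋆
  ⋆-mono p≤q r<p = ℚ.<-≤-trans r<p p≤q

  ⋆-cancel : ∀ {p q} → p ⋆ ≤ q ⋆ → p ℚ.≤ q
  ⋆-cancel {p} {q} h = ℚ.≮⇒≥ (λ q<p → ℚ.<-irrefl refl (h q<p))

  ≰⋆⇒≥ : ∀ {q} x → ¬ (q ⋆ ≤ x) → x ≤ q ⋆
  ≰⋆⇒≥ {q} x q≰x {r} r∈x = decidable-stable (r ℚ.<? q) (λ r≮q →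
    q≰x (λ s<q → down x (ℚ.<-≤-trans s<q (ℚ.≮⇒≥ r≮q)) r∈x))

  frac-≤-suc : ∀ P n e → e ℕ.< at P n →
               frac P e (suc n) ℚ.+ frac P 1 (suc n) ℚ.≤ frac P 1 n
  frac-≤-suc P n e e<p = subst₂ ℚ._≤_
    (trans (cong (λ k → frac P k (suc n)) (ℕ.+-comm 1 e)) (sym (/-+ (+ e) (+ 1) (∏ P (suc n)) {{∏-nonZero P (suc n)}})))
    (cancel/ (∏ P n) (at P n) {{∏-nonZero P n}} {{at-nonZero P n}} {{∏-nonZero P (suc n)}})
    (/-mono (∏ P (suc n)) {{∏-nonZero P (suc n)}} (ℤ.+≤+ e<p))

  frac-≡-suc : ∀ P n e → suc e ≡ at P n →
               frac P e (suc n) ℚ.+ frac P 1 (suc n) ≡ frac P 1 n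
  frac-≡-suc P n e e≡p = trans
    (/-+ (+ e) (+ 1) (∏ P (suc n)) {{∏-nonZero P (suc n)}})
    (trans (cong (λ k → frac P k (suc n)) (trans (ℕ.+-comm e 1) e≡p))
    (cancel/ (∏ P n) (at P n) {{∏-nonZero P n}} {{at-nonZero P n}} {{∏-nonZero P (suc n)}}))

  0≤frac : ∀ P e n → 0ℚ ℚ.≤ frac P e n
  0≤frac P e n = subst (ℚ._≤ frac P e n) (ℚ.0/n≡0 (∏ P n) {{∏-nonZero P n}})
    (/-mono {+ 0} {+ e} (∏ P n) {{∏-nonZero P n}} (ℤ.+≤+ z≤n))

  ≤-+ʳ : ∀ p {q} → 0ℚ ℚ.≤ q → p ℚ.≤ p ℚ.+ q
  ≤-+ʳ p 0≤q = subst (ℚ._≤ p ℚ.+ _) (ℚ.+-identityʳ p) (ℚ.+-monoʳ-≤ p 0≤q)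

  frac-small : ∀ P ε → 0ℚ ℚ.< ε → ∃[ N ] ∀ n → N ℕ.≤ n → frac P 1 n ℚ.< ε
  frac-small P ε 0<ε with k , small ← 1/small ε 0<ε =
    k , λ n k≤n → small (∏ P n) {{∏-nonZero P n}} (ℕ.≤-<-trans k≤n (n<∏ P n))

  0<q-p : ∀ {p q} → p ℚ.< q → 0ℚ ℚ.< q ℚ.- p
  0<q-p {p} {q} p<q = subst (ℚ._< q ℚ.- p) (ℚ.+-inverseʳ p) (ℚ.+-monoˡ-< (ℚ.- p) p<q)

  p+[q-p] : ∀ p q → p ℚ.+ (q ℚ.- p) ≡ q
  p+[q-p] p q = trans (cong (p ℚ.+_) (ℚ.+-comm q (ℚ.- p)))
    (trans (sym (ℚ.+-assoc p (ℚ.- p) q))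
    (trans (cong (ℚ._+ q) (ℚ.+-inverseʳ p)) (ℚ.+-identityˡ q)))

  squeeze : ∀ P (s : ℕ → ℚ) x → (∀ n → s n ⋆ ≤ x) →
            (∀ n → x ≤ (s n ℚ.+ frac P 1 n) ⋆) → s ⟶ x
  squeeze P s x lo hi ε 0<ε with N , small ← frac-small P ε 0<ε = N , λ n N≤n →
    let s-ε<s = subst (s n ℚ.- ε ℚ.<_) (ℚ.+-identityʳ (s n))
                  (ℚ.+-monoʳ-< (s n) (ℚ.neg-antimono-< 0<ε))
        s+w<s+ε = ℚ.+-monoʳ-< (s n) (small n N≤n)
    in ( (λ r< → lo n (ℚ.<-trans r< s-ε<s))
       , λ h → ℚ.<-irrefl refl (ℚ.<-≤-trans s-ε<s (⋆-cancel (λ r< → h (lo n r<)))) )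
     , ( (λ r∈ → ℚ.<-trans (hi n r∈) s+w<s+ε)
       , λ h → ℚ.<-irrefl refl (ℚ.<-≤-trans s+w<s+ε (⋆-cancel (λ r< → hi n (h r<)))) )

  module _ (P : BasicSequence) (e : ℕ → ℕ) where

    digitSum-mono : ∀ {m n} → m ℕ.≤′ n → digitSum P e m ℚ.≤ digitSum P e n
    digitSum-mono ℕ.≤′-refl = ℚ.≤-refl
    digitSum-mono (ℕ.≤′-step {n} m≤n) =
      ℚ.≤-trans (digitSum-mono m≤n) (≤-+ʳ (digitSum P e n) (0≤frac P (e n) (suc n)))

    upper : ℕ → ℚ
    upper n = digitSum P e n ℚ.+ frac P 1 n

    upper-anti : (∀ n → e n ℕ.< at P n) → ∀ {m n} → m ℕ.≤′ n → upper n ℚ.≤ upper m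
    upper-anti e<p ℕ.≤′-refl = ℚ.≤-refl
    upper-anti e<p (ℕ.≤′-step {n} m≤n) = ℚ.≤-trans
      (subst (ℚ._≤ upper n) (sym (ℚ.+-assoc (digitSum P e n) (frac P (e n) (suc n)) (frac P 1 (suc n))))
        (ℚ.+-monoʳ-≤ (digitSum P e n) (frac-≤-suc P n (e n) (e<p n))))
      (upper-anti e<p m≤n)

    digitSum≤upper : (∀ n → e n ℕ.< at P n) → ∀ m n → digitSum P e m ℚ.≤ upper n
    digitSum≤upper e<p m n with ℕ.≤-total m n
    ... | inj₁ m≤n = ℚ.≤-trans (digitSum-mono (ℕ.≤⇒≤′ m≤n)) (≤-+ʳ _ (0≤frac P 1 n))
    ... | inj₂ n≤m = ℚ.≤-trans (≤-+ʳ _ (0≤frac P 1 m)) (upper-anti e<p (ℕ.≤⇒≤′ n≤m))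

    upper-const : ∀ {m} → (∀ n → m ℕ.≤ n → suc (e n) ≡ at P n) →
                  ∀ {n} → m ℕ.≤′ n → upper n ≡ upper m
    upper-const max ℕ.≤′-refl = refl
    upper-const max (ℕ.≤′-step {n} m≤n) = trans
      (trans (ℚ.+-assoc (digitSum P e n) (frac P (e n) (suc n)) (frac P 1 (suc n)))
        (cong (digitSum P e n ℚ.+_) (frac-≡-suc P n (e n) (max n (ℕ.≤′⇒≤ m≤n)))))
      (upper-const max m≤n)

open Lemmas

-- Terms are nonnegative, so the sum of a digit series is constructed as the
-- supremum of its partial sums; digitSum⟶ shows that it is their limit.

digitValue : ∀ P e → (∀ n → e n ℕ.< at P n) → ℝ
digitValue P e e<p = record
  { lower     = λ q → ∃[ n ] q ℚ.< digitSum P e n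
  ; inhabited = 0ℚ ℚ.- 1ℚ , 0 , q-1<q 0ℚ
  ; proper    = 1ℚ , λ (n , 1<s) → ℚ.<-irrefl refl (ℚ.<-≤-trans 1<s (digitSum≤upper P e e<p n 0))
  ; down      = λ p<q (n , q<s) → n , ℚ.<-trans p<q q<s
  ; rounded   = λ (n , p<s) → let (r , p<r , r<s) = ℚ.<-dense p<s in r , p<r , n , r<s
  }

digitSum⟶ : ∀ P e (e<p : ∀ n → e n ℕ.< at P n) → digitSum P e ⟶ digitValue P e e<p
digitSum⟶ P e e<p = squeeze P (digitSum P e) (digitValue P e e<p)
  (λ n r<s → n , r<s)
  (λ n (m , r<s) → ℚ.<-≤-trans r<s (digitSum≤upper P e e<p m n))

module _ (lem : ExcludedMiddle 0ℓ) (P : BasicSequence) (x : ℝ) where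
  private
    search : (f : ℕ → ℚ) → f 0 ⋆ ≤ x → ∀ k → ¬ (f k ⋆ ≤ x) →
             ∃[ e ] e ℕ.< k × f e ⋆ ≤ x × ¬ (f (suc e) ⋆ ≤ x)
    search f f0≤x zero    ¬fk = ⊥-elim (¬fk f0≤x)
    search f f0≤x (suc k) ¬fk with lem {f k ⋆ ≤ x}
    ... | yes fk = k , ℕ.≤-refl , fk , ¬fk
    ... | no ¬fk′ with e , e<k , h ← search f f0≤x k ¬fk′ = e , ℕ.m<n⇒m<1+n e<k , h

    floor : ∃[ i ] (i / 1) ⋆ ≤ x × ¬ (((i ℤ.+ + 1) / 1) ⋆ ≤ x)
    floor with inhabited x | proper x
    ... | q , q∈x | r , r∉x =
      let a = ℤ.∣ ℚ.↥ (ℚ.- q) ∣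
          b = ℤ.∣ ℚ.↥ r ∣
          i = -[1+ a ]
          top : i ℤ.+ + (suc a ℕ.+ suc (suc b)) ≡ + suc (suc b)
          top = trans (cong (λ j → i ℤ.+ j) (ℤ.pos-+ (suc a) (suc (suc b))))
                  (trans (sym (ℤ.+-assoc i (+ suc a) (+ suc (suc b))))
                  (trans (cong (ℤ._+ + suc (suc b)) (ℤ.+-inverseˡ (+ suc a)))
                  (ℤ.+-identityˡ (+ suc (suc b)))))
          r<top : r ℚ.< + suc (suc b) / 1
          r<top = ℚ.≤-<-trans (≤-bound r) (subst (+ suc b / 1 ℚ.<_)
            (trans (/-+ (+ suc b) (+ 1) 1) (cong (λ k → + k / 1) (ℕ.+-comm (suc b) 1)))
            (subst (ℚ._< (+ suc b / 1) ℚ.+ 1ℚ) (ℚ.+-identityʳ (+ suc b / 1))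
              (ℚ.+-monoʳ-< (+ suc b / 1) (ℚ.positive⁻¹ 1ℚ))))
          (k , _ , lo , hi) = search (λ k → (i ℤ.+ + k) / 1)
            (λ s< → down x (ℚ.<-≤-trans s< (subst (ℚ._≤ q)
               (cong (_/ 1) (sym (ℤ.+-identityʳ i))) (bound-≤ q))) q∈x)
            (suc a ℕ.+ suc (suc b))
            (λ h → r∉x (h (subst (r ℚ.<_) (cong (_/ 1) (sym top)) r<top)))
      in i ℤ.+ + k , lo ,
         λ h → hi (subst (λ j → (j / 1) ⋆ ≤ x)
           (trans (ℤ.+-assoc i (+ k) (+ 1)) (cong (λ j → i ℤ.+ + j) (ℕ.+-comm k 1))) h)

    e₀ : ℤ
    e₀ = proj₁ floor

    State : ℕ → Set
    State n = ∃[ a ] a ⋆ ≤ x × ¬ ((a ℚ.+ frac P 1 n) ⋆ ≤ x)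

    next : ∀ n ((a , _) : State n) → ∃[ e ] e ℕ.< at P n ×
           (a ℚ.+ frac P e (suc n)) ⋆ ≤ x × ¬ ((a ℚ.+ frac P (suc e) (suc n)) ⋆ ≤ x)
    next n (a , lo , hi) = search (λ e → a ℚ.+ frac P e (suc n))
      (subst (λ b → b ⋆ ≤ x) (sym (trans (cong (a ℚ.+_)
        (ℚ.0/n≡0 (∏ P (suc n)) {{∏-nonZero P (suc n)}})) (ℚ.+-identityʳ a))) lo)
      (at P n)
      (subst (λ b → ¬ ((a ℚ.+ b) ⋆ ≤ x))
        (sym (cancel/ (∏ P n) (at P n) {{∏-nonZero P n}} {{at-nonZero P n}} {{∏-nonZero P (suc n)}})) hi)

    state : ∀ n → State n
    state zero    = e₀ / 1 , proj₁ (proj₂ floor) ,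
      subst (λ b → ¬ (b ⋆ ≤ x)) (sym (/-+ e₀ (+ 1) 1)) (proj₂ (proj₂ floor))
    state (suc n) with state n
    ... | st@(a , _) with next n st
    ... | e , _ , lo , hi = a ℚ.+ frac P e (suc n) , lo ,
      subst (λ b → ¬ (b ⋆ ≤ x)) (sym (trans (ℚ.+-assoc a _ _) (cong (a ℚ.+_)
        (trans (/-+ (+ e) (+ 1) (∏ P (suc n)) {{∏-nonZero P (suc n)}})
          (cong (λ k → frac P k (suc n)) (ℕ.+-comm e 1)))))) hi

    e : ℕ → ℕ
    e n = proj₁ (next n (state n))

    s : ℕ → ℚ
    s n = (e₀ / 1) ℚ.+ digitSum P e n

    state-s : ∀ n → proj₁ (state n) ≡ s n
    state-s zero    = sym (ℚ.+-identityʳ (e₀ / 1))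
    state-s (suc n) = trans (cong (ℚ._+ frac P (e n) (suc n)) (state-s n))
      (ℚ.+-assoc (e₀ / 1) (digitSum P e n) (frac P (e n) (suc n)))

    lo : ∀ n → s n ⋆ ≤ x
    lo n = subst (λ b → b ⋆ ≤ x) (state-s n) (proj₁ (proj₂ (state n)))

    hi : ∀ n → ¬ ((s n ℚ.+ frac P 1 n) ⋆ ≤ x)
    hi n = subst (λ b → ¬ ((b ℚ.+ frac P 1 n) ⋆ ≤ x)) (state-s n) (proj₂ (proj₂ (state n)))

    suc∸1 : ∀ n → suc (at P n ℕ.∸ 1) ≡ at P n
    suc∸1 n = ℕ.suc-pred (at P n) {{at-nonZero P n}}

    notEventuallyMax : ∀ N → ¬ (∀ n → N ℕ.≤ n → e n ≡ at P n ℕ.∸ 1)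
    notEventuallyMax N max = hi N λ {q} q<u →
      let u = s N ℚ.+ frac P 1 N
          (M , small) = frac-small P (u ℚ.- q) (0<q-p q<u)
          n = N ℕ.⊔ M
          w = frac P 1 n
          u≡ : s n ℚ.+ w ≡ u
          u≡ = trans (ℚ.+-assoc (e₀ / 1) (digitSum P e n) w)
            (trans (cong ((e₀ / 1) ℚ.+_) (upper-const P e
              (λ k N≤k → trans (cong suc (max k N≤k)) (suc∸1 k)) (ℕ.≤⇒≤′ (ℕ.m≤m⊔n N M))))
            (sym (ℚ.+-assoc (e₀ / 1) (digitSum P e N) (frac P 1 N))))
          q+w<s+w : q ℚ.+ w ℚ.< s n ℚ.+ w
          q+w<s+w = subst (q ℚ.+ w ℚ.<_) (trans (p+[q-p] q u) (sym u≡))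
            (ℚ.+-monoʳ-< q (small n (ℕ.m≤n⊔m N M)))
      in lo n (ℚ.≰⇒> (λ s≤q → ℚ.<-irrefl refl
           (ℚ.<-≤-trans q+w<s+w (ℚ.+-monoˡ-≤ w s≤q))))

  expansion : Expansion P x
  expansion = record
    { E₀        = e₀
    ; E₀≤x      = proj₁ (proj₂ floor)
    ; x<E₀+1    = ≰⋆⇒≥ x (proj₂ (proj₂ floor)) , proj₂ (proj₂ floor)
    ; E         = e
    ; E<p       = λ n → proj₁ (proj₂ (next n (state n)))
    ; E≢p-1     = λ N → decidable-stable lem λ none → notEventuallyMax N λ n N≤n →
                    decidable-stable (e n ℕ.≟ at P n ℕ.∸ 1) λ e≢ → none (n , N≤n , e≢)
    ; converges = squeeze P s x lo (λ n → ≰⋆⇒≥ x (hi n))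
    }

-- Excluded middle enters the definition of ψ only through `expansion`, the
-- existence of the digits Eₙ of an arbitrary real.

ψ : ExcludedMiddle 0ℓ → BasicSequence → BasicSequence → ℝ → ℝ
ψ lem P Q x = digitValue Q (λ n → E n ℕ.⊓ (at Q n ℕ.∸ 1)) λ n →
  ℕ.≤-<-trans (ℕ.m⊓n≤n (E n) (at Q n ℕ.∸ 1))
    (ℕ.≤-reflexive (ℕ.suc-pred (at Q n) {{at-nonZero Q n}}))
  where open Expansion (expansion lem P x)

{-# OPTIONS --safe #-}

-- If pₙ > qₙ, then inside any cylinder of rank n - 1 the digit pairs (qₙ - 1, 1)
-- and (qₙ, 0), continued by zeros, are increasing as reals, while min(-, qₙ - 1)
-- erases the difference in the first digit and so makes ψ decrease; the
-- cylinder's left endpoint has a smaller ψ than either.  If pₙ ≤ qₙ for all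
-- n > N, then on a cylinder of rank N the minimum changes nothing except in
-- fixed digits, and ψ preserves the lexicographic order of digit sequences,
-- which is the order of the reals.

module Submission where

open import Defs
open import Axiom.ExcludedMiddle using (ExcludedMiddle)
open import Data.Nat using (_>_)
open import Function.Bundles using (_⇔_; mk⇔)
open import Level using (0ℓ)
open import Data.Empty using (⊥-elim)
open import Data.Integer as ℤ using (+_)
import Data.Integer.Properties as ℤ
open import Data.Nat as ℕ using (ℕ; zero; suc; s≤s; z≤n)
import Data.Nat.Properties as ℕ
open import Data.Product using (∃-syntax; _×_; _,_; proj₁; proj₂)
open import Data.Rational as ℚ using (ℚ; 0ℚ; _/_)
import Data.Rational.Properties as ℚ
open import Data.Sum using (_⊎_; inj₁; inj₂)
open import Relation.Binary.PropositionalEquality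
  using (_≡_; _≢_; refl; sym; trans; cong; cong₂; subst; subst₂)
open import Relation.Binary.Definitions using (tri<; tri≈; tri>)
open import Relation.Nullary using (¬_; yes; no)
open import Relation.Nullary.Decidable using (decidable-stable)
open import Relation.Unary using (Pred; _∈_; _∉_)
open import Function using (_∘_)

open Lemmas
open ℝ
open Expansion

-- Rational bounds on cuts and limits

∉⇒≤⋆ : ∀ {r} x → r ∉ lower x → x ≤ r ⋆
∉⇒≤⋆ {r} x r∉x {q} q∈x with q ℚ.<? r
... | yes q<r = q<r
... | no q≮r = ⊥-elim (r∉x (r≤q⇒r∈x (ℚ.≮⇒≥ q≮r)))
  where
  r≤q⇒r∈x : r ℚ.≤ q → r ∈ lower x
  -- `down` needs a strict inequality, so `rounded` first supplies an element above `q`; this covers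
  -- `r ≡ q`.
  r≤q⇒r∈x r≤q with rounded x q∈x
  ... | _ , q<s , s∈x = down x (ℚ.≤-<-trans r≤q q<s) s∈x

⋆-mono-< : ∀ {p q} → p ℚ.< q → p ⋆ < q ⋆
⋆-mono-< p<q = ⋆-mono (ℚ.<⇒≤ p<q) , λ q≤p → ℚ.<-irrefl refl (ℚ.<-≤-trans p<q (⋆-cancel q≤p))

-- For `q < r < l`, the tolerance `l - r` keeps `s n - ε` at or above `r`, hence above `q`.
⟶-≥ : ∀ {s x l} N → s ⟶ x → (∀ n → N ℕ.≤ n → l ℚ.≤ s n) → l ⋆ ≤ x
⟶-≥ {s} {x} {l} N s⟶x l≤s {q} q<l with ℚ.<-dense q<l
... | r , q<r , r<l with s⟶x (l ℚ.- r) (0<q-p r<l)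
... | M , close = proj₁ (proj₁ (close n (ℕ.m≤n⊔m N M))) (ℚ.<-≤-trans q<r r≤s-ε)
  where
  n = N ℕ.⊔ M
  ε = l ℚ.- r
  r≤s-ε : r ℚ.≤ s n ℚ.- ε
  r≤s-ε = ℚ.≮⇒≥ λ s-ε<r → ℚ.<-irrefl refl (ℚ.<-≤-trans
    (subst₂ ℚ._<_
      (trans (ℚ.+-assoc (s n) (ℚ.- ε) ε)
        (trans (cong (s n ℚ.+_) (ℚ.+-inverseˡ ε)) (ℚ.+-identityʳ (s n))))
      (p+[q-p] r l)
      (ℚ.+-monoˡ-< ε s-ε<r))
    (l≤s n (ℕ.m≤m⊔n N M)))

⟶-≤ : ∀ {s x u} → s ⟶ x → (∀ n → s n ℚ.≤ u) → x ≤ u ⋆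
⟶-≤ {s} {x} {u} s⟶x s≤u {q} q∈x with rounded x q∈x
... | r , q<r , r∈x with s⟶x (r ℚ.- q) (0<q-p q<r)
... | M , close = ℚ.≰⇒> λ u≤q → ℚ.<-irrefl refl (ℚ.<-≤-trans
  (proj₁ (proj₂ (close M ℕ.≤-refl)) r∈x)
  (subst (s M ℚ.+ (r ℚ.- q) ℚ.≤_) (p+[q-p] q r)
    (ℚ.+-monoˡ-≤ (r ℚ.- q) (ℚ.≤-trans (s≤u M) u≤q))))

-- Digit fractions and partial sums

frac-suc : ∀ P e n → frac P e n ℚ.+ frac P 1 n ≡ frac P (suc e) n
frac-suc P e n = trans (/-+ (+ e) (+ 1) (∏ P n) {{∏-nonZero P n}})
  (cong (λ k → frac P k n) (ℕ.+-comm e 1))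

frac-zero : ∀ P n → frac P 0 n ≡ 0ℚ
frac-zero P n = ℚ.0/n≡0 (∏ P n) {{∏-nonZero P n}}

frac-mono-≤ : ∀ P {a b} n → a ℕ.≤ b → frac P a n ℚ.≤ frac P b n
frac-mono-≤ P n a≤b = /-mono (∏ P n) {{∏-nonZero P n}} (ℤ.+≤+ a≤b)

0<frac : ∀ P {a} n → 0 ℕ.< a → 0ℚ ℚ.< frac P a n
0<frac P {suc a} n _ = ℚ.positive⁻¹ (frac P (suc a) n)
  {{ℚ.normalize-pos (suc a) (∏ P n) {{∏-nonZero P n}}}}

<-+ʳ : ∀ p {q} → 0ℚ ℚ.< q → p ℚ.< p ℚ.+ q
<-+ʳ p 0<q = subst (ℚ._< p ℚ.+ _) (ℚ.+-identityʳ p) (ℚ.+-monoʳ-< p 0<q)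

digitSum-cong : ∀ P {e f} n → (∀ {k} → k ℕ.< n → e k ≡ f k) → digitSum P e n ≡ digitSum P f n
digitSum-cong P zero    e≡f = refl
digitSum-cong P (suc n) e≡f = cong₂ ℚ._+_
  (digitSum-cong P n (e≡f ∘ ℕ.m<n⇒m<1+n))
  (cong (λ k → frac P k (suc n)) (e≡f ℕ.≤-refl))

-- Up to `m` the sums increase, and from `m` on they are constant, so the sum at `m` bounds all of
-- them, as a supremum requires.
digitSum-vanishing : ∀ P e {m} → (∀ {k} → m ℕ.≤ k → e k ≡ 0) → ∀ n → digitSum P e n ℚ.≤ digitSum P e m
digitSum-vanishing P e {m} e≡0 n with ℕ.≤-total n m
... | inj₁ n≤m = digitSum-mono P e (ℕ.≤⇒≤′ n≤m)
... | inj₂ m≤n = ℚ.≤-reflexive (constant (ℕ.≤⇒≤′ m≤n))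
  where
  constant : ∀ {n} → m ℕ.≤′ n → digitSum P e n ≡ digitSum P e m
  constant ℕ.≤′-refl = refl
  constant (ℕ.≤′-step {n} m≤n) = trans
    (cong (digitSum P e n ℚ.+_)
      (trans (cong (λ k → frac P k (suc n)) (e≡0 (ℕ.≤′⇒≤ m≤n))) (frac-zero P (suc n))))
    (trans (ℚ.+-identityʳ (digitSum P e n)) (constant m≤n))

upper-suc : ∀ P e n → upper P e (suc n) ≡ digitSum P e n ℚ.+ frac P (suc (e n)) (suc n)
upper-suc P e n = trans (ℚ.+-assoc (digitSum P e n) (frac P (e n) (suc n)) (frac P 1 (suc n)))
  (cong (digitSum P e n ℚ.+_) (frac-suc P (e n) (suc n)))

-- A digit that is not maximal leaves room for one more unit of rank `suc n`. This is the source of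
-- strictness at right endpoints.
upper-decreasing : ∀ P e n → suc (e n) ℕ.< at P n → upper P e (suc n) ℚ.< upper P e n
upper-decreasing P e n 1+e<p = subst (ℚ._< upper P e n) (sym (upper-suc P e n))
  (ℚ.+-monoʳ-< (digitSum P e n)
    (ℚ.<-≤-trans (<-+ʳ _ (0<frac P {1} (suc n) (s≤s z≤n))) (frac-≤-suc P n (suc (e n)) 1+e<p)))

-- Lexicographic comparison: the first larger digit gains at least one unit of rank `suc n`, which
-- is all that the later digits of `e` can add.
upper≤digitSum : ∀ P {e f} n → (∀ {k} → k ℕ.< n → e k ≡ f k) → e n ℕ.< f n →
                 upper P e (suc n) ℚ.≤ digitSum P f (suc n)
upper≤digitSum P {e} {f} n e≡f e<f = subst (ℚ._≤ digitSum P f (suc n))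
  (sym (trans (upper-suc P e n) (cong (ℚ._+ _) (digitSum-cong P n e≡f))))
  (ℚ.+-monoʳ-≤ (digitSum P f n) (frac-mono-≤ P (suc n) e<f))

suc-pred-at : ∀ P n → suc (at P n ℕ.∸ 1) ≡ at P n
suc-pred-at P n = ℕ.suc-pred (at P n) {{at-nonZero P n}}

0<at-1 : ∀ P n → 0 ℕ.< at P n ℕ.∸ 1
0<at-1 P n = ℕ.∸-monoˡ-≤ 1 (2≤at P n)

-- Cylinders and the order of expansions

module _ {P x} (X : Expansion P x) where

  partialSum : ℕ → ℚ
  partialSum n = (E₀ X / 1) ℚ.+ digitSum P (E X) n

  partialSum≤ : ∀ n → partialSum n ⋆ ≤ x
  partialSum≤ n = ⟶-≥ {x = x} n (converges X) λ m n≤m →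
    ℚ.+-monoʳ-≤ (E₀ X / 1) (digitSum-mono P (E X) (ℕ.≤⇒≤′ n≤m))

  -- Cylinders are half-open: some digit at `j ≥ n` is not maximal, so `x` is at most the upper
  -- bound of rank `suc j`, which is strictly below that of rank `j` and so below that of rank `n`.
  <partialSum+frac : ∀ n → ¬ ((partialSum n ℚ.+ frac P 1 n) ⋆ ≤ x)
  <partialSum+frac n u≤x with E≢p-1 X n
  ... | j , n≤j , Ej≢p-1 = ℚ.<-irrefl refl (ℚ.≤-<-trans
      (⋆-cancel λ r<u → ⟶-≤ {x = x} (converges X)
        (λ m → ℚ.+-monoʳ-≤ (E₀ X / 1) (digitSum≤upper P (E X) (E<p X) m (suc j)))
        (u≤x (subst (_ ℚ.<_) (sym (ℚ.+-assoc (E₀ X / 1) _ _)) r<u)))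
      (ℚ.+-monoʳ-< (E₀ X / 1) (ℚ.<-≤-trans
        (upper-decreasing P (E X) j
          (ℕ.≤∧≢⇒< (E<p X j) λ 1+E≡p → Ej≢p-1 (cong (ℕ._∸ 1) 1+E≡p)))
        (upper-anti P (E X) (E<p X) (ℕ.≤⇒≤′ n≤j)))))

-- Membership in a common cylinder of rank `n`, expressed through digits instead of endpoints.
record Agree {P x y} (X : Expansion P x) (Y : Expansion P y) (n : ℕ) : Set where
  constructor agree
  field
    integer : E₀ X ≡ E₀ Y
    digit   : ∀ {k} → k ℕ.< n → E X k ≡ E Y k

open Agree

Agree-trans : ∀ {P x y z n} {X : Expansion P x} {Y : Expansion P y} {Z : Expansion P z} →
              Agree X Y n → Agree Y Z n → Agree X Z n
Agree-trans (agree i d) (agree i′ d′) = agree (trans i i′) (λ k<n → trans (d k<n) (d′ k<n))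

Agree-sym : ∀ {P x y n} {X : Expansion P x} {Y : Expansion P y} → Agree X Y n → Agree Y X n
Agree-sym (agree i d) = agree (sym i) (sym ∘ d)

module _ {P x y} (X : Expansion P x) (Y : Expansion P y) (x≤y : x ≤ y) where

  E₀-mono : E₀ X ℤ.≤ E₀ Y
  E₀-mono = ℤ.≮⇒≥ λ E₀Y<E₀X → proj₂ (x<E₀+1 Y) λ r< →
    x≤y (E₀≤x X (ℚ.<-≤-trans r<
      (/-mono 1 (subst (ℤ._≤ E₀ X) (ℤ.+-comm (+ 1) (E₀ Y)) (ℤ.i<j⇒suc[i]≤j E₀Y<E₀X)))))

  -- If the digit dropped, the whole cylinder of `y` of rank `suc n` would end at or before a
  -- partial sum of `x`, contradicting the strict upper bound on `y`.
  E-mono : ∀ {n} → Agree X Y n → E X n ℕ.≤ E Y n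
  E-mono {n} (agree E₀≡ E≡) = ℕ.≮⇒≥ λ EY<EX → <partialSum+frac Y (suc n) λ r< →
    x≤y (partialSum≤ X (suc n) (ℚ.<-≤-trans r<
      (subst₂ ℚ._≤_
        (trans (cong (λ i → (i / 1) ℚ.+ _) E₀≡) (sym (ℚ.+-assoc (E₀ Y / 1) _ _)))
        refl
        (ℚ.+-monoʳ-≤ (E₀ X / 1) (upper≤digitSum P n (sym ∘ E≡) EY<EX)))))

-- Induction on the rank: once the earlier digits agree, `E-mono` applied on both sides squeezes the
-- next digit.
Agree-between : ∀ {P x y z} (X : Expansion P x) (Y : Expansion P y) (Z : Expansion P z) →
                x ≤ y → y ≤ z → ∀ {n} → Agree X Z n → Agree X Y n
Agree-between X Y Z x≤y y≤z = go _
  where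
  go : ∀ n → Agree X Z n → Agree X Y n
  go zero    (agree E₀≡ _)  = agree
    (ℤ.≤-antisym (E₀-mono X Y x≤y) (subst (E₀ Y ℤ.≤_) (sym E₀≡) (E₀-mono Y Z y≤z))) λ ()
  go (suc n) (agree E₀≡ E≡) = agree (integer ih) λ k<1+n → digit′ (ℕ.m<1+n⇒m<n∨m≡n k<1+n)
    where
    XZ = agree E₀≡ (E≡ ∘ ℕ.m<n⇒m<1+n)
    ih = go n XZ
    digit′ : ∀ {k} → k ℕ.< n ⊎ k ≡ n → E X k ≡ E Y k
    digit′ (inj₁ k<n)  = digit ih k<n
    digit′ (inj₂ refl) = ℕ.≤-antisym (E-mono X Y x≤y ih)
      (subst (E Y n ℕ.≤_) (sym (E≡ ℕ.≤-refl))
        (E-mono Y Z y≤z (Agree-trans {X = Y} {X} {Z} (Agree-sym {X = X} {Y} ih) XZ)))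

-- A real lies between itself and itself. This lets explicit expansions replace the one chosen by
-- excluded middle.
Agree-unique : ∀ {P x n} (X Y : Expansion P x) → Agree X Y n
Agree-unique X Y = Agree-between X Y X (λ q → q) (λ q → q) (agree refl (λ _ → refl))

-- Terminating expansions

finiteExpansion : ∀ P i e {m} → (∀ n → e n ℕ.< at P n) → (∀ {k} → m ℕ.≤ k → e k ≡ 0) →
                  Expansion P (((i / 1) ℚ.+ digitSum P e m) ⋆)
finiteExpansion P i e {m} e<p e≡0 = record
  { E₀        = i
  ; E₀≤x      = ⋆-mono (≤-+ʳ (i / 1) (digitSum-mono P e (ℕ.≤⇒≤′ (z≤n {m}))))
  ; x<E₀+1    = ⋆-mono-< (subst ((i / 1) ℚ.+ digitSum P e m ℚ.<_) (/-+ i (+ 1) 1)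
      (ℚ.+-monoʳ-< (i / 1) (ℚ.<-≤-trans (<-+ʳ (digitSum P e m) (0<frac P {1} m (s≤s z≤n)))
        (upper-anti P e e<p (ℕ.≤⇒≤′ (z≤n {m}))))))
  ; E         = e
  ; E<p       = e<p
  -- Past `m` every digit is 0, whereas the maximal digit is at least 1.
  ; E≢p-1     = λ N → N ℕ.⊔ m , ℕ.m≤m⊔n N m , λ e≡p-1 →
      ℕ.<-irrefl (trans (sym (e≡0 (ℕ.m≤n⊔m N m))) e≡p-1) (0<at-1 P (N ℕ.⊔ m))
  ; converges = squeeze P _ (((i / 1) ℚ.+ digitSum P e m) ⋆)
      (λ n → ⋆-mono (ℚ.+-monoʳ-≤ (i / 1) (digitSum-vanishing P e e≡0 n)))
      (λ n → ⋆-mono (subst ((i / 1) ℚ.+ digitSum P e m ℚ.≤_) (sym (ℚ.+-assoc (i / 1) _ _))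
        (ℚ.+-monoʳ-≤ (i / 1) (digitSum≤upper P e e<p m n))))
  }

-- The digits `f 0, …, f (n - 1), a, 0, 0, …`: those of the left endpoint of a subcylinder of rank
-- `suc n`.
extend : (ℕ → ℕ) → ℕ → ℕ → ℕ → ℕ
extend f zero    a zero    = a
extend f zero    a (suc k) = 0
extend f (suc n) a zero    = f zero
extend f (suc n) a (suc k) = extend (f ∘ suc) n a k

extend-< : ∀ f n a {k} → k ℕ.< n → extend f n a k ≡ f k
extend-< f (suc n) a {zero}  k<n       = refl
extend-< f (suc n) a {suc k} (s≤s k<n) = extend-< (f ∘ suc) n a k<n

extend-≡ : ∀ f n a → extend f n a n ≡ a
extend-≡ f zero    a = refl
extend-≡ f (suc n) a = extend-≡ (f ∘ suc) n a

extend-> : ∀ f n a {k} → n ℕ.< k → extend f n a k ≡ 0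
extend-> f zero    a (s≤s n<k) = refl
extend-> f (suc n) a (s≤s n<k) = extend-> (f ∘ suc) n a n<k

extend-bounded : ∀ (b f : ℕ → ℕ) n {a} → (∀ k → f k ℕ.< b k) → a ℕ.< b n → ∀ k → extend f n a k ℕ.< b k
extend-bounded b f n {a} f<b a<b k with ℕ.<-cmp k n
... | tri< k<n _ _  = subst (ℕ._< b k) (sym (extend-< f n a k<n)) (f<b k)
... | tri≈ _ refl _ = subst (ℕ._< b k) (sym (extend-≡ f n a)) a<b
... | tri> _ _ n<k  = subst (ℕ._< b k) (sym (extend-> f n a n<k)) (ℕ.≤-<-trans z≤n (f<b k))

digitSum-extend : ∀ P f n a → digitSum P (extend f n a) (suc n) ≡ digitSum P f n ℚ.+ frac P a (suc n)
digitSum-extend P f n a = cong₂ ℚ._+_ (digitSum-cong P n (extend-< f n a))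
  (cong (λ k → frac P k (suc n)) (extend-≡ f n a))

-- Capped digits

cap : BasicSequence → (ℕ → ℕ) → ℕ → ℕ
cap Q e n = e n ℕ.⊓ (at Q n ℕ.∸ 1)

cap-bounded : ∀ Q e n → cap Q e n ℕ.< at Q n
cap-bounded Q e n = ℕ.≤-<-trans (ℕ.m⊓n≤n (e n) (at Q n ℕ.∸ 1)) (ℕ.≤-reflexive (suc-pred-at Q n))

-- Capping acts digit by digit and fixes 0, so the trailing zeros survive.
cap-extend : ∀ Q (f : ℕ → ℕ) n a k → cap Q (extend f n a) k ≡ extend (cap Q f) n (a ℕ.⊓ (at Q n ℕ.∸ 1)) k
cap-extend Q f n a k with ℕ.<-cmp k n
... | tri< k<n _ _  = trans (cong (ℕ._⊓ _) (extend-< f n a k<n)) (sym (extend-< (cap Q f) n _ k<n))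
... | tri≈ _ refl _ = trans (cong (ℕ._⊓ _) (extend-≡ f n a)) (sym (extend-≡ (cap Q f) n _))
... | tri> _ _ n<k  = trans (cong (ℕ._⊓ _) (extend-> f n a n<k)) (sym (extend-> (cap Q f) n _ n<k))

digitSum-cap-extend : ∀ Q f n a → digitSum Q (cap Q (extend f n a)) (suc n) ≡
                      digitSum Q (cap Q f) n ℚ.+ frac Q (a ℕ.⊓ (at Q n ℕ.∸ 1)) (suc n)
digitSum-cap-extend Q f n a = trans
  (digitSum-cong Q (suc n) (λ {k} _ → cap-extend Q f n a k))
  (digitSum-extend Q (cap Q f) n _)

-- Lexicographic order and monotonicity on a cylinder

-- A bounded search suffices, because membership in the cut of a `ψ` value is witnessed by a single
-- partial sum.
firstDifference : ∀ (e f : ℕ → ℕ) m → (∀ {k} → k ℕ.< m → e k ≡ f k) ⊎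
  ∃[ k ] (∀ {j} → j ℕ.< k → e j ≡ f j) × e k ≢ f k
firstDifference e f zero    = inj₁ λ ()
firstDifference e f (suc m) with firstDifference e f m
... | inj₂ d = inj₂ d
... | inj₁ e≡f with e m ℕ.≟ f m
... | no e≢f   = inj₂ (m , e≡f , e≢f)
... | yes em≡fm = inj₁ λ k<1+m → extended (ℕ.m<1+n⇒m<n∨m≡n k<1+m)
  where
  extended : ∀ {k} → k ℕ.< m ⊎ k ≡ m → e k ≡ f k
  extended (inj₁ k<m)  = e≡f k<m
  extended (inj₂ refl) = em≡fm

module _ (lem : ExcludedMiddle 0ℓ) (P Q : BasicSequence) where

  private
    digits : ∀ x → Expansion P x
    digits = expansion lem P

  -- If the first `m` digits coincide, the same partial sum is a witness. Otherwise the first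
  -- difference `k` satisfies `N ≤ k`, the capped digits still increase there, and the sum for `y`
  -- through position `k` bounds every sum for `x`.
  ψ-monotoneOn-cylinder : ∀ {N t} (T : Expansion P t) → (∀ n → N ℕ.≤ n → at P n ℕ.≤ at Q n) →
                          NonDecreasingOn (ψ lem P Q) (λ x → Agree T (digits x) N)
  ψ-monotoneOn-cylinder {N} T p≤q {x} {y} x∈I y∈I x≤y {r} (m , r<) =
    result (firstDifference (E X) (E Y) m)
    where
    X = digits x
    Y = digits y
    XY : Agree X Y N
    XY = Agree-trans {X = X} {T} {Y} (Agree-sym {X = T} {X} x∈I) y∈I
    c = cap Q (E X)
    d = cap Q (E Y)
    result : (∀ {k} → k ℕ.< m → E X k ≡ E Y k) ⊎
             (∃[ k ] (∀ {j} → j ℕ.< k → E X j ≡ E Y j) × E X k ≢ E Y k) →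
             ∃[ n ] r ℚ.< digitSum Q d n
    result (inj₁ EX≡EY) = m , subst (r ℚ.<_) (digitSum-cong Q m (cong (ℕ._⊓ _) ∘ EX≡EY)) r<
    result (inj₂ (k , EX≡EY , EX≢EY)) = suc k , ℚ.<-≤-trans r<
      (ℚ.≤-trans (digitSum≤upper Q c (cap-bounded Q (E X)) m (suc k))
        (upper≤digitSum Q k (cong (ℕ._⊓ _) ∘ EX≡EY) c<d))
      where
      N≤k : N ℕ.≤ k
      N≤k = ℕ.≮⇒≥ λ k<N → EX≢EY (digit XY k<N)
      EX<EY : E X k ℕ.< E Y k
      EX<EY = ℕ.≤∧≢⇒< (E-mono X Y x≤y (agree (integer XY) EX≡EY)) EX≢EY
      d≡EY : d k ≡ E Y k
      d≡EY = ℕ.m≤n⇒m⊓n≡m (ℕ.∸-monoˡ-≤ 1 (ℕ.≤-trans (E<p Y k) (p≤q k N≤k)))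
      -- Only the digit of `y` has to escape the cap; capping that of `x` can only lower it.
      c<d : c k ℕ.< d k
      c<d = ℕ.≤-<-trans (ℕ.m⊓n≤m (E X k) _) (subst (E X k ℕ.<_) (sym d≡EY) EX<EY)

  -- Cylinders as non-degenerate intervals

  module _ {t} (T : Expansion P t) (n : ℕ) where

    private
      i = E₀ T
      f = E T

    cylinder-isInterval : IsInterval (λ x → Agree T (digits x) n)
    cylinder-isInterval {x} {y} {z} x∈I z∈I x≤y y≤z =
      Agree-trans {X = T} {digits x} {digits y} x∈I
        (Agree-between (digits x) (digits y) (digits z) x≤y y≤z
          (Agree-trans {X = digits x} {T} {digits z} (Agree-sym {X = T} {digits x} x∈I) z∈I))

    cylinderPoint : ℕ → ℚ
    cylinderPoint a = (i / 1) ℚ.+ digitSum P (extend f n a) (suc n)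

    cylinderPoint-expansion : ∀ {a} → a ℕ.< at P n → Expansion P (cylinderPoint a ⋆)
    cylinderPoint-expansion {a} a<p = finiteExpansion P i (extend f n a)
      (extend-bounded (at P) f n (E<p T) a<p) (extend-> f n a)

    -- The explicit terminating expansion lies in the cylinder, and uniqueness transfers this to the
    -- chosen `digits`.
    cylinderPoint-∈ : ∀ {a} → a ℕ.< at P n → Agree T (digits (cylinderPoint a ⋆)) n
    cylinderPoint-∈ {a} a<p = Agree-trans {X = T} {C} {digits (cylinderPoint a ⋆)}
      (agree refl (λ k<n → sym (extend-< f n a k<n)))
      (Agree-unique C (digits (cylinderPoint a ⋆)))
      where C = cylinderPoint-expansion a<p

    cylinder-nonDegenerate : NonDegenerate (λ x → Agree T (digits x) n)
    cylinder-nonDegenerate = cylinderPoint 0 ⋆ , cylinderPoint 1 ⋆ ,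
      cylinderPoint-∈ (ℕ.≤-trans (s≤s z≤n) (2≤at P n)) , cylinderPoint-∈ (2≤at P n) ,
      ⋆-mono-< (ℚ.+-monoʳ-< (i / 1) (subst₂ ℚ._<_
        (sym (digitSum-extend P f n 0)) (sym (digitSum-extend P f n 1))
        (ℚ.+-monoʳ-< (digitSum P f n)
          (subst (ℚ._< frac P 1 (suc n)) (sym (frac-zero P (suc n))) (0<frac P (suc n) (s≤s z≤n))))))

  -- Failure of monotonicity inside a cylinder

  digitSum-digits : ∀ {z} (Z : Expansion P z) n →
                    digitSum Q (cap Q (E Z)) n ≡ digitSum Q (cap Q (E (digits z))) n
  digitSum-digits {z} Z n = digitSum-cong Q n
    (cong (ℕ._⊓ _) ∘ digit (Agree-unique {n = n} Z (digits z)))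

  -- The rational `r` lies in the cut of `ψ` at `y` but not in that at `x`.
  ψ-≰ : ∀ {x y} (X : Expansion P x) (Y : Expansion P y) {r m} →
        (∀ n → digitSum Q (cap Q (E X)) n ℚ.≤ r) → r ℚ.< digitSum Q (cap Q (E Y)) m →
        ¬ (ψ lem P Q y ≤ ψ lem P Q x)
  ψ-≰ {x} {y} X Y {r} {m} ≤r r< ψy≤ψx
    with n , r<′ ← ψy≤ψx (m , subst (r ℚ.<_) (digitSum-digits Y m) r<) =
    ℚ.<-irrefl refl (ℚ.<-≤-trans (subst (r ℚ.<_) (sym (digitSum-digits X n)) r<′) (≤r n))

  -- The value at the middle point exceeds `r` and the outer two do not: the drop from `y` to `z`
  -- refutes non-decrease, the rise from `x` to `y` non-increase.
  peak⇒not-monotoneOn : ∀ {x y z} (X : Expansion P x) (Y : Expansion P y) (Z : Expansion P z) {r m} →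
                        (∀ n → digitSum Q (cap Q (E X)) n ℚ.≤ r) →
                        r ℚ.< digitSum Q (cap Q (E Y)) m →
                        (∀ n → digitSum Q (cap Q (E Z)) n ℚ.≤ r) →
                        x ≤ y → y ≤ z → {I : Pred ℝ 0ℓ} → x ∈ I → y ∈ I → z ∈ I →
                        ¬ MonotoneOn (ψ lem P Q) I
  peak⇒not-monotoneOn {y = y} {z} X Y Z {m = m} X≤r r<Y Z≤r x≤y y≤z x∈I y∈I z∈I (inj₁ nonDecreasing) =
    ψ-≰ Z Y {m = m} Z≤r r<Y (nonDecreasing {y} {z} y∈I z∈I y≤z)
  peak⇒not-monotoneOn {x} {y} X Y Z {m = m} X≤r r<Y Z≤r x≤y y≤z x∈I y∈I z∈I (inj₂ nonIncreasing) =
    ψ-≰ X Y {m = m} X≤r r<Y (nonIncreasing {x} {y} x∈I y∈I x≤y)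

  module _ {t} (T : Expansion P t) (n : ℕ) (q<p : at Q n ℕ.< at P n) where

    private
      i = E₀ T
      f = E T
      q = at Q n
      0<p : 0 ℕ.< at P n
      0<p = ℕ.≤-<-trans z≤n q<p
      q-1<q : q ℕ.∸ 1 ℕ.< q
      q-1<q = ℕ.≤-reflexive (suc-pred-at Q n)
      -- The digit `q - 1` is the largest that the cap leaves alone. `peak` appends a digit 1 after
      -- it; `valley` has `q` in its place, which is capped back to `q - 1`.
      T′ = cylinderPoint-expansion T n (ℕ.<-trans q-1<q q<p)
      f′ = E T′
      left peak valley : ℚ
      left   = cylinderPoint T n 0
      peak   = cylinderPoint T′ (suc n) 1
      valley = cylinderPoint T n q
      Left   = cylinderPoint-expansion T n 0<p
      Peak   = cylinderPoint-expansion T′ (suc n) (2≤at P (suc n))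
      Valley = cylinderPoint-expansion T n q<p

      start≤left : partialSum T n ℚ.≤ left
      start≤left = ℚ.+-monoʳ-≤ (i / 1) (subst (digitSum P f n ℚ.≤_)
        (sym (digitSum-extend P f n 0)) (≤-+ʳ (digitSum P f n) (0≤frac P 0 (suc n))))

      left≤peak : left ℚ.≤ peak
      left≤peak = ℚ.+-monoʳ-≤ (i / 1) (begin
        digitSum P (extend f n 0) (suc n)
          ≡⟨ digitSum-extend P f n 0 ⟩
        digitSum P f n ℚ.+ frac P 0 (suc n)
          ≤⟨ ℚ.+-monoʳ-≤ (digitSum P f n) (frac-mono-≤ P {0} {q ℕ.∸ 1} (suc n) z≤n) ⟩
        digitSum P f n ℚ.+ frac P (q ℕ.∸ 1) (suc n)
          ≡⟨ digitSum-extend P f n (q ℕ.∸ 1) ⟨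
        digitSum P f′ (suc n)
          ≤⟨ ≤-+ʳ (digitSum P f′ (suc n)) (0≤frac P 1 (suc (suc n))) ⟩
        digitSum P f′ (suc n) ℚ.+ frac P 1 (suc (suc n))
          ≡⟨ digitSum-extend P f′ (suc n) 1 ⟨
        digitSum P (extend f′ (suc n) 1) (suc (suc n)) ∎)
        where open ℚ.≤-Reasoning

      peak≤valley : peak ℚ.≤ valley
      peak≤valley = ℚ.+-monoʳ-≤ (i / 1) (begin
        digitSum P (extend f′ (suc n) 1) (suc (suc n))
          ≡⟨ digitSum-extend P f′ (suc n) 1 ⟩
        digitSum P f′ (suc n) ℚ.+ frac P 1 (suc (suc n))
          -- The appended 1 is worth at most one unit of rank `suc n`, exactly the gap between the
          -- digits `q - 1` and `q`.
          ≤⟨ ℚ.+-monoʳ-≤ (digitSum P f′ (suc n)) (subst (ℚ._≤ frac P 1 (suc n))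
               (frac-suc P 0 (suc (suc n))) (frac-≤-suc P (suc n) 0 (ℕ.<⇒≤ (2≤at P (suc n))))) ⟩
        upper P f′ (suc n)
          ≤⟨ upper≤digitSum P n
               (λ k<n → trans (extend-< f n (q ℕ.∸ 1) k<n) (sym (extend-< f n q k<n)))
               (subst₂ ℕ._<_ (sym (extend-≡ f n (q ℕ.∸ 1))) (sym (extend-≡ f n q)) q-1<q) ⟩
        digitSum P (extend f n q) (suc n) ∎)
        where open ℚ.≤-Reasoning

      valley≤end : valley ℚ.≤ partialSum T n ℚ.+ frac P 1 n
      valley≤end = subst (valley ℚ.≤_) (sym (ℚ.+-assoc (i / 1) (digitSum P f n) (frac P 1 n)))
        (ℚ.+-monoʳ-≤ (i / 1) (begin
          digitSum P (extend f n q) (suc n)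
            ≡⟨ digitSum-extend P f n q ⟩
          digitSum P f n ℚ.+ frac P q (suc n)
            ≤⟨ ℚ.+-monoʳ-≤ (digitSum P f n) (ℚ.≤-trans
                 (≤-+ʳ (frac P q (suc n)) (0≤frac P 1 (suc n))) (frac-≤-suc P n q q<p)) ⟩
          digitSum P f n ℚ.+ frac P 1 n ∎))
        where open ℚ.≤-Reasoning

      base : ℕ → ℚ
      base c = digitSum Q (cap Q f) n ℚ.+ frac Q c (suc n)

      -- Uniform in `a`, so it serves both `left` and `valley`: whatever digit follows the prefix,
      -- it is capped at `q - 1`.
      capped≤ : ∀ a m → digitSum Q (cap Q (extend f n a)) m ℚ.≤ base (q ℕ.∸ 1)
      capped≤ a m = begin
        digitSum Q (cap Q (extend f n a)) m
          ≤⟨ digitSum-vanishing Q _ (λ n<k → cong (ℕ._⊓ _) (extend-> f n a n<k)) m ⟩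
        digitSum Q (cap Q (extend f n a)) (suc n)
          ≡⟨ digitSum-cap-extend Q f n a ⟩
        base (a ℕ.⊓ (q ℕ.∸ 1))
          ≤⟨ ℚ.+-monoʳ-≤ (digitSum Q (cap Q f) n)
               (frac-mono-≤ Q (suc n) (ℕ.m⊓n≤n a (q ℕ.∸ 1))) ⟩
        base (q ℕ.∸ 1) ∎
        where open ℚ.≤-Reasoning

      -- The appended digit 1 survives capping because the next term of `Q` is at least 2.
      <capped-peak : base (q ℕ.∸ 1) ℚ.< digitSum Q (cap Q (E Peak)) (suc (suc n))
      <capped-peak = subst₂ ℚ._<_
        (trans (digitSum-cap-extend Q f n (q ℕ.∸ 1)) (cong base (ℕ.⊓-idem (q ℕ.∸ 1))))
        (sym (digitSum-cap-extend Q f′ (suc n) 1))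
        (<-+ʳ (digitSum Q (cap Q f′) (suc n))
          (0<frac Q (suc (suc n)) (ℕ.⊓-glb ℕ.≤-refl (0<at-1 Q (suc n)))))

    not-monotoneOn : ∀ {I : Pred ℝ 0ℓ} →
                     (∀ {z} → partialSum T n ℚ.≤ z → z ℚ.≤ partialSum T n ℚ.+ frac P 1 n →
                       (z ⋆) ∈ I) →
                     ¬ MonotoneOn (ψ lem P Q) I
    not-monotoneOn ⊆I = peak⇒not-monotoneOn Left Peak Valley {m = suc (suc n)}
      (capped≤ 0) <capped-peak (capped≤ q) (⋆-mono left≤peak) (⋆-mono peak≤valley)
      (⊆I start≤left (ℚ.≤-trans left≤peak (ℚ.≤-trans peak≤valley valley≤end)))
      (⊆I (ℚ.≤-trans start≤left left≤peak) (ℚ.≤-trans peak≤valley valley≤end))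
      (⊆I (ℚ.≤-trans start≤left (ℚ.≤-trans left≤peak peak≤valley)) valley≤end)

  -- Fitting cylinders into intervals, and the two implications

  <⇒separated : ∀ {x y} → x < y → ∃[ r ] r ∉ lower x × r ∈ lower y
  <⇒separated {x} {y} (_ , y≰x) = decidable-stable lem λ none →
    y≰x λ {r} r∈y → decidable-stable lem λ r∉x → none (r , r∉x , r∈y)

  -- The cylinder of rank `n` around `t` is narrower than the distance from `t` to `r` and to `u`,
  -- so it lies strictly between them.
  not-monotoneOn-⊇ : ∀ {r t u} (T : Expansion P (t ⋆)) n → at Q n ℕ.< at P n →
                     frac P 1 n ℚ.< t ℚ.- r → frac P 1 n ℚ.< u ℚ.- t →
                     ∀ {I} → (∀ {z} → r ℚ.< z → z ℚ.< u → (z ⋆) ∈ I) →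
                     ¬ MonotoneOn (ψ lem P Q) I
  not-monotoneOn-⊇ {r} {t} {u} T n q<p w<t-r w<u-t ⊆I =
    not-monotoneOn T n q<p λ s≤z z≤s+w → ⊆I (ℚ.<-≤-trans r<s s≤z) (ℚ.≤-<-trans z≤s+w s+w<u)
    where
    s = partialSum T n
    w = frac P 1 n
    t<s+w : t ℚ.< s ℚ.+ w
    t<s+w = ℚ.≰⇒> λ s+w≤t → <partialSum+frac T n (⋆-mono s+w≤t)
    r<s : r ℚ.< s
    r<s = ℚ.≰⇒> λ s≤r → ℚ.<-asym t<s+w (ℚ.≤-<-trans (ℚ.+-monoˡ-≤ w s≤r)
      (subst (r ℚ.+ w ℚ.<_) (p+[q-p] r t) (ℚ.+-monoʳ-< r w<t-r)))
    s+w<u : s ℚ.+ w ℚ.< u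
    s+w<u = ℚ.≤-<-trans (ℚ.+-monoˡ-≤ w (⋆-cancel (partialSum≤ T n)))
      (subst (t ℚ.+ w ℚ.<_) (p+[q-p] t u) (ℚ.+-monoʳ-< t w<u-t))

  infinitelyOften⇒monotoneOnNoInterval :
    InfinitelyOften (λ n → at P n > at Q n) → MonotoneOnNoInterval (ψ lem P Q)
  infinitelyOften⇒monotoneOnNoInterval often (I , interval , (x , y , x∈I , y∈I , x<y) , monotone) =
    -- The open interval from `r` to `u` lies between `x` and `y`, and `t` in its interior leaves
    -- room for a cylinder on both sides.
    let r , r∉x , r∈y = <⇒separated {x} {y} x<y
        u , r<u , u∈y = rounded y r∈y
        t , r<t , t<u = ℚ.<-dense r<u
        N , small     = frac-small P (t ℚ.- r) (0<q-p r<t)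
        M , small′    = frac-small P (u ℚ.- t) (0<q-p t<u)
        n , N⊔M≤n , q<p = often (N ℕ.⊔ M)
    in not-monotoneOn-⊇ (digits (t ⋆)) n q<p
         (small n (ℕ.m⊔n≤o⇒m≤o N M N⊔M≤n)) (small′ n (ℕ.m⊔n≤o⇒n≤o N M N⊔M≤n))
         (λ {z} r<z z<u → interval {x} {z ⋆} {y} x∈I y∈I
           (λ q∈x → ℚ.<-trans (∉⇒≤⋆ x r∉x q∈x) r<z)
           (λ q<z → down y (ℚ.<-trans q<z z<u) u∈y))
         monotone

  monotoneOnNoInterval⇒infinitelyOften :
    MonotoneOnNoInterval (ψ lem P Q) → InfinitelyOften (λ n → at P n > at Q n)
  monotoneOnNoInterval⇒infinitelyOften nowhere N = decidable-stable lem λ none →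
    nowhere (_ , cylinder-isInterval T N , cylinder-nonDegenerate T N ,
      inj₁ (ψ-monotoneOn-cylinder T λ n N≤n → ℕ.≮⇒≥ λ q<p → none (n , N≤n , q<p)))
    -- Any real would do as the centre; 0 merely selects one cylinder of rank `N`.
    where T = digits (0ℚ ⋆)

theorem2p25 : (lem : ExcludedMiddle 0ℓ) (P Q : BasicSequence) →
    MonotoneOnNoInterval (ψ lem P Q) ⇔ InfinitelyOften (λ n → at P n > at Q n)
theorem2p25 lem P Q = mk⇔ (monotoneOnNoInterval⇒infinitelyOften lem P Q)
                          (infinitelyOften⇒monotoneOnNoInterval lem P Q)
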